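{- Let a product two-action game with $m$ players, with data $\underline v$ and $a^i_j$ as in the context, be given. For $\pi\in S_m$ put $$EC(\pi):=\{\underline\gamma\in[0,1]^m \mid L(\underline\gamma)=F(\pi),\ \gamma^j=a^{\pi(j)}_j \text{ for all } j\in\mathcal A\setminus F(\pi)\}.$$ Then the set of equilibrium candidates of the game equals $\bigcup_{\pi\in S_m}EC(\pi)$, and this union is disjoint. Moreover $|EC(\pi)|=2^{|F(\pi)|}$ for every $\pi\in S_m$, and the total number of equilibrium candidates is $$\sum_{l=0}^m\binom{m}{l}2^l\cdot !(m-l)=V(m).$$
   Context: Fix an integer $m\ge 1$ and $\mathcal A=\{1,\dots,m\}$. A two-action game is a finite game in normal form with player set $\mathcal A$ in which each player $i$ has exactly two pure strategies $s^i_0,s^i_1$, together with utility functions $U^i:S\to\mathbb R$, where $S=\prod_{i\in\mathcal A}\{s^i_0,s^i_1\}$. A mixed strategy combination is identified with $\underline\gamma=(\gamma^1,\dots,\gamma^m)\in[0,1]^m$, where $\gamma^i$ is the probability with which player $i$ plays $s^i_1$. The expected utility $V^i$ is the multilinear extension $V^i(\underline\gamma)=\sum_{(j_1,\dots,j_m)\in\{0,1\}^m}\prod_{k=1}^m p_k(j_k)\,U^i(s^1_{j_1},\dots,s^m_{j_m})$ with $p_k(1)=\gamma^k$, $p_k(0)=1-\gamma^k$. Write $\underline\gamma^{ -i}=(\gamma^j)_{j\ne i}$ and $\lambda^i(\underline\gamma^{ -i}):=V^i(\underline\gamma)|_{\gamma^i=1}-V^i(\underline\gamma)|_{\gamma^i=0}$,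 a polynomial in $\underline\gamma^{ -i}$. A Nash equilibrium is a point $\underline\gamma\in[0,1]^m$ such that for every $i$: $\lambda^i(\underline\gamma^{ -i})=0$ if $0<\gamma^i<1$; $\lambda^i(\underline\gamma^{ -i})\le 0$ if $\gamma^i=0$; $\lambda^i(\underline\gamma^{ -i})\ge 0$ if $\gamma^i=1$. An equilibrium candidate is a point $\underline\gamma\in[0,1]^m$ with $\lambda^i(\underline\gamma^{ -i})=0$ for every $i$ with $0<\gamma^i<1$. For $\underline\gamma$ put $L_0(\underline\gamma)=\{i:\gamma^i=0\}$, $L_1(\underline\gamma)=\{i:\gamma^i=1\}$, $L(\underline\gamma)=L_0(\underline\gamma)\cup L_1(\underline\gamma)$. A two-action game is a product two-action game if there exist $\underline v=(v_1,\dots,v_m)\in\{0,1\}^m$ and numbers $a^i_j\in(0,1)$ for $i,j\in\mathcal A$, $i\ne j$, with $a^{i_1}_j\neq a^{i_2}_j$ whenever $i_1\neq i_2$ and both differ from $j$, such that $\lambda^i(\underline\gamma^{ -i})=(-1)^{v_i}\prod_{j\in\mathcal A\setminus\{i\}}(\gamma^j-a^i_j)$ for every $i\in\mathcal A$. For $\pi\in S_m$, $F(\pi)=\{i\in\mathcal A:\pi(i)=i\}$ is its set of fixed points. $\mathrm{Der}_m$ denotes the set of derangements (permutations without fixed points) in $S_m$, and the subfactorial $!n$ is the number of derangements of an $n$-element set ($!0=1$, $!1=0$). $V(m):=\sum_{l=0}^m\binom{m}{l}2^l\cdot!(m-l)$. -}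

module Defs where

open import Algebra.Bundles.Raw using (RawRing)
import Algebra.Definitions.RawSemiring as RawSemiringDefinitions
open import Data.Bool.Base using (if_then_else_)
open import Data.Fin.Base using (Fin; zero; suc; toℕ)
open import Data.Fin.Permutation using (Permutation′; _⟨$⟩ʳ_)
open import Data.Fin.Properties using (_≟_; all?; any?)
open import Data.Fin.Subset using (Subset; _∈_; _∉_)
open import Data.List.Base using (List; []; _∷_; allFin; cartesianProductWith; filter; foldr; length; map; upTo)
open import Data.Nat.Base as ℕ using (ℕ; zero; suc)
open import Data.Nat.Combinatorics using (_C_)
open import Data.Nat.ListAction using (sum)
import Data.Nat.Properties as ℕ
open import Data.Product.Base using (∃-syntax; _×_; _,_; proj₁; proj₂)
open import Data.Rational.Base as ℚ using (ℚ; 0ℚ; 1ℚ; ½; ∣_∣)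
import Data.Rational.Properties as ℚ
open import Data.Rational.Solver using (module +-*-Solver)
open import Data.Sum.Base using (_⊎_)
open import Data.Vec.Base as Vec using (Vec; lookup; tabulate)
open import Data.Vec.Functional using (Vector; updateAt)
import Data.Vec.Functional.Relation.Binary.Equality.Setoid as VectorEquality
open import Function.Base using (const)
open import Function.Bundles using (Bijection)
open import Function.Definitions using (Injective; Surjective; Bijective)
open import Level using (0ℓ)
open import Relation.Binary.Bundles using (Setoid)
import Relation.Binary.Construct.On as On
open import Relation.Binary.PropositionalEquality as ≡ using (_≡_; _≢_; refl; cong; subst)
open import Relation.Nullary.Decidable using (Dec; does; map′; ¬?; _×-dec_; _→-dec_)
open import Relation.Nullary.Negation using (¬_)
open import Relation.Unary using (Pred; _∪_; _≐_; Decidable)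

-- Real numbers: Cauchy sequences of rationals, with equality _≈_ "the
-- difference is a null sequence".

Cauchy : (ℕ → ℚ) → Set
Cauchy x = ∀ ε → 0ℚ ℚ.< ε → ∃[ N ] ∀ k l → N ℕ.≤ k → N ℕ.≤ l → ∣ x k ℚ.- x l ∣ ℚ.< ε

record ℝ : Set where
  constructor mkℝ
  field
    seq    : ℕ → ℚ
    cauchy : Cauchy seq

open ℝ public

infix 4 _≈_ _≉_ _<_ _≤_

record _≈_ (x y : ℝ) : Set where
  constructor mk≈
  field
    null : ∀ ε → 0ℚ ℚ.< ε → ∃[ N ] ∀ n → N ℕ.≤ n → ∣ seq x n ℚ.- seq y n ∣ ℚ.< ε

open _≈_ public

_≉_ : ℝ → ℝ → Set
x ≉ y = ¬ (x ≈ y)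

record _<_ (x y : ℝ) : Set where
  constructor mk<
  field
    gap   : ℚ
    gap>0 : 0ℚ ℚ.< gap
    from  : ℕ
    apart : ∀ n → from ℕ.≤ n → seq x n ℚ.+ gap ℚ.≤ seq y n

open _<_ public

_≤_ : ℝ → ℝ → Set
x ≤ y = x < y ⊎ x ≈ y

private
  half-pos : ∀ {ε} → 0ℚ ℚ.< ε → 0ℚ ℚ.< ½ ℚ.* ε
  half-pos {ε} ε>0 = ℚ.positive⁻¹ (½ ℚ.* ε) {{ℚ.pos*pos⇒pos ½ ε {{ℚ.positive ε>0}}}}

  half+half : ∀ ε → ½ ℚ.* ε ℚ.+ ½ ℚ.* ε ≡ ε
  half+half ε = ≡.trans (≡.sym (ℚ.*-distribʳ-+ ε ½ ½)) (ℚ.*-identityˡ ε)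

  ∣p+q∣<r+s : ∀ p q {r s} → ∣ p ∣ ℚ.< r → ∣ q ∣ ℚ.< s → ∣ p ℚ.+ q ∣ ℚ.< r ℚ.+ s
  ∣p+q∣<r+s p q p<r q<s = ℚ.≤-<-trans (ℚ.∣p+q∣≤∣p∣+∣q∣ p q) (ℚ.+-mono-< p<r q<s)

  ∣p-q∣≡∣q-p∣ : ∀ p q → ∣ p ℚ.- q ∣ ≡ ∣ q ℚ.- p ∣
  ∣p-q∣≡∣q-p∣ p q = ≡.trans (≡.sym (ℚ.∣-p∣≡∣p∣ (p ℚ.- q))) (cong ∣_∣ (lemma p q))
    where
    open +-*-Solver
    lemma : ∀ p q → ℚ.- (p ℚ.- q) ≡ q ℚ.- p
    lemma = solve 2 (λ p q → :- (p :- q) := q :- p) refl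

  ∣p-p∣<ε : ∀ p {ε} → 0ℚ ℚ.< ε → ∣ p ℚ.- p ∣ ℚ.< ε
  ∣p-p∣<ε p {ε} = subst (ℚ._< ε) (cong ∣_∣ (≡.sym (ℚ.+-inverseʳ p)))

≈-refl : ∀ {x} → x ≈ x
≈-refl {x} = mk≈ λ ε ε>0 → 0 , λ n _ → ∣p-p∣<ε (seq x n) ε>0

≈-sym : ∀ {x y} → x ≈ y → y ≈ x
≈-sym {x} {y} x≈y = mk≈ λ ε ε>0 →
  let (N , h) = null x≈y ε ε>0
  in N , λ n N≤n → subst (ℚ._< ε) (∣p-q∣≡∣q-p∣ (seq x n) (seq y n)) (h n N≤n)

≈-trans : ∀ {x y z} → x ≈ y → y ≈ z → x ≈ z
≈-trans {x} {y} {z} x≈y y≈z = mk≈ λ ε ε>0 →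
  let (M , f) = null x≈y _ (half-pos ε>0)
      (N , g) = null y≈z _ (half-pos ε>0)
  in M ℕ.⊔ N , λ n M⊔N≤n →
    ≡.subst₂ ℚ._<_ (cong ∣_∣ (lemma (seq x n) (seq y n) (seq z n))) (half+half ε)
      (∣p+q∣<r+s (seq x n ℚ.- seq y n) (seq y n ℚ.- seq z n)
        (f n (ℕ.m⊔n≤o⇒m≤o M N M⊔N≤n))
        (g n (ℕ.m⊔n≤o⇒n≤o M N M⊔N≤n)))
  where
  open +-*-Solver
  lemma : ∀ p q r → (p ℚ.- q) ℚ.+ (q ℚ.- r) ≡ p ℚ.- r
  lemma = solve 3 (λ p q r → (p :- q) :+ (q :- r) := p :- r) refl

ℝ-setoid : Setoid 0ℓ 0ℓ
ℝ-setoid = record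
  { Carrier       = ℝ
  ; _≈_           = _≈_
  ; isEquivalence = record
    { refl  = ≈-refl
    ; sym   = ≈-sym
    ; trans = ≈-trans
    }
  }

fromℚ : ℚ → ℝ
fromℚ q = mkℝ (const q) λ ε ε>0 → 0 , λ _ _ _ _ → ∣p-p∣<ε q ε>0

private
  +-cauchy : ∀ {x y} → Cauchy x → Cauchy y → Cauchy (λ n → x n ℚ.+ y n)
  +-cauchy {x} {y} cx cy ε ε>0 with cx _ (half-pos ε>0) | cy _ (half-pos ε>0)
  ... | M , f | N , g = M ℕ.⊔ N , λ k l M⊔N≤k M⊔N≤l →
    ≡.subst₂ ℚ._<_ (cong ∣_∣ (lemma (x k) (x l) (y k) (y l))) (half+half ε)
      (∣p+q∣<r+s (x k ℚ.- x l) (y k ℚ.- y l)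
        (f k l (ℕ.m⊔n≤o⇒m≤o M N M⊔N≤k) (ℕ.m⊔n≤o⇒m≤o M N M⊔N≤l))
        (g k l (ℕ.m⊔n≤o⇒n≤o M N M⊔N≤k) (ℕ.m⊔n≤o⇒n≤o M N M⊔N≤l)))
    where
    open +-*-Solver
    lemma : ∀ p q r s → (p ℚ.- q) ℚ.+ (r ℚ.- s) ≡ (p ℚ.+ r) ℚ.- (q ℚ.+ s)
    lemma = solve 4 (λ p q r s → (p :- q) :+ (r :- s) := (p :+ r) :- (q :+ s)) refl

  neg-cauchy : ∀ {x} → Cauchy x → Cauchy (λ n → ℚ.- x n)
  neg-cauchy {x} cx ε ε>0 with cx ε ε>0
  ... | N , f = N , λ k l N≤k N≤l →
    subst (ℚ._< ε) (cong ∣_∣ (lemma (x l) (x k))) (f l k N≤l N≤k)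
    where
    open +-*-Solver
    lemma : ∀ p q → p ℚ.- q ≡ (ℚ.- q) ℚ.- (ℚ.- p)
    lemma = solve 2 (λ p q → p :- q := (:- q) :- (:- p)) refl

  bounded : ∀ {x} → Cauchy x →
            ∃[ B ] 0ℚ ℚ.< B × ∃[ N ] ∀ n → N ℕ.≤ n → ∣ x n ∣ ℚ.≤ B
  bounded {x} cx with cx 1ℚ (ℚ.positive⁻¹ 1ℚ)
  ... | N , f =
    1ℚ ℚ.+ ∣ x N ∣ ,
    ℚ.+-mono-<-≤ (ℚ.positive⁻¹ 1ℚ) (ℚ.0≤∣p∣ (x N)) ,
    N , λ n N≤n → subst (λ p → ∣ p ∣ ℚ.≤ 1ℚ ℚ.+ ∣ x N ∣) (lemma (x n) (x N))
      (ℚ.≤-trans (ℚ.∣p+q∣≤∣p∣+∣q∣ (x n ℚ.- x N) (x N))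
        (ℚ.+-monoˡ-≤ ∣ x N ∣ (ℚ.<⇒≤ (f n N N≤n ℕ.≤-refl))))
    where
    open +-*-Solver
    lemma : ∀ p q → (p ℚ.- q) ℚ.+ q ≡ p
    lemma = solve 2 (λ p q → (p :- q) :+ q := p) refl

  ∣p*q∣<B*δ : ∀ p q {B δ} → 0ℚ ℚ.< B → ∣ p ∣ ℚ.≤ B → ∣ q ∣ ℚ.< δ → ∣ p ℚ.* q ∣ ℚ.< B ℚ.* δ
  ∣p*q∣<B*δ p q {B} B>0 p≤B q<δ = subst (ℚ._< _) (≡.sym (ℚ.∣p*q∣≡∣p∣*∣q∣ p q))
    (ℚ.≤-<-trans (ℚ.*-monoʳ-≤-nonNeg ∣ q ∣ {{ℚ.∣-∣-nonNeg q}} p≤B)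
      (ℚ.*-monoʳ-<-pos B {{ℚ.positive B>0}} q<δ))

  split : ∀ {B ε} → 0ℚ ℚ.< B → 0ℚ ℚ.< ε → ∃[ δ ] 0ℚ ℚ.< δ × B ℚ.* δ ≡ ε
  split {B} {ε} B>0 ε>0 =
    1/B ℚ.* ε ,
    ℚ.positive⁻¹ (1/B ℚ.* ε) {{ℚ.pos*pos⇒pos 1/B {{ℚ.1/pos⇒pos B {{posB}}}} ε {{ℚ.positive ε>0}}}} ,
    ≡.trans (≡.sym (ℚ.*-assoc B 1/B ε))
      (≡.trans (cong (ℚ._* ε) (ℚ.*-inverseʳ B {{nzB}})) (ℚ.*-identityˡ ε))
    where
    posB = ℚ.positive B>0
    nzB  = ℚ.pos⇒nonZero B {{posB}}
    1/B  = ℚ.1/_ B {{nzB}}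

  pr-qs : ∀ p q r s → p ℚ.* (r ℚ.- s) ℚ.+ s ℚ.* (p ℚ.- q) ≡ p ℚ.* r ℚ.- q ℚ.* s
  pr-qs = solve 4 (λ p q r s → p :* (r :- s) :+ s :* (p :- q) := p :* r :- q :* s) refl
    where open +-*-Solver

  ∣pr-qs∣<ε : ∀ p q r s {A B δ ε} → 0ℚ ℚ.< A → 0ℚ ℚ.< B → (A ℚ.+ B) ℚ.* δ ≡ ε →
              ∣ p ∣ ℚ.≤ A → ∣ s ∣ ℚ.≤ B → ∣ p ℚ.- q ∣ ℚ.< δ → ∣ r ℚ.- s ∣ ℚ.< δ →
              ∣ p ℚ.* r ℚ.- q ℚ.* s ∣ ℚ.< ε
  ∣pr-qs∣<ε p q r s {A} {B} {δ} A>0 B>0 eq p≤A s≤B p-q<δ r-s<δ =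
    ≡.subst₂ ℚ._<_ (cong ∣_∣ (pr-qs p q r s)) (≡.trans (≡.sym (ℚ.*-distribʳ-+ δ A B)) eq)
      (∣p+q∣<r+s (p ℚ.* (r ℚ.- s)) (s ℚ.* (p ℚ.- q))
        (∣p*q∣<B*δ p (r ℚ.- s) A>0 p≤A r-s<δ)
        (∣p*q∣<B*δ s (p ℚ.- q) B>0 s≤B p-q<δ))

  *-cauchy : ∀ {x y} → Cauchy x → Cauchy y → Cauchy (λ n → x n ℚ.* y n)
  *-cauchy {x} {y} cx cy ε ε>0 =
    let (A , A>0 , M , boundx) = bounded {x} cx
        (B , B>0 , N , boundy) = bounded {y} cy
        (δ , δ>0 , eq)         = split {A ℚ.+ B} {ε} (ℚ.+-mono-< {0ℚ} {A} {0ℚ} {B} A>0 B>0) ε>0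
        (P , f)                = cx δ δ>0
        (Q , g)                = cy δ δ>0
        left  = λ k → ℕ.≤-trans {_} {_} {k} (ℕ.m≤m⊔n (M ℕ.⊔ N) (P ℕ.⊔ Q))
        right = λ k → ℕ.≤-trans {_} {_} {k} (ℕ.m≤n⊔m (M ℕ.⊔ N) (P ℕ.⊔ Q))
    in (M ℕ.⊔ N) ℕ.⊔ (P ℕ.⊔ Q) , λ k l k≥ l≥ →
      ∣pr-qs∣<ε (x k) (x l) (y k) (y l) {A} {B} {δ} {ε} A>0 B>0 eq
        (boundx k (ℕ.m⊔n≤o⇒m≤o M N (left k k≥)))
        (boundy l (ℕ.m⊔n≤o⇒n≤o M N (left l l≥)))
        (f k l (ℕ.m⊔n≤o⇒m≤o P Q (right k k≥)) (ℕ.m⊔n≤o⇒m≤o P Q (right l l≥)))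
        (g k l (ℕ.m⊔n≤o⇒n≤o P Q (right k k≥)) (ℕ.m⊔n≤o⇒n≤o P Q (right l l≥)))

ℝ-rawRing : RawRing 0ℓ 0ℓ
ℝ-rawRing = record
  { Carrier = ℝ
  ; _≈_     = _≈_
  ; _+_     = λ x y → mkℝ (λ n → seq x n ℚ.+ seq y n) (+-cauchy {seq x} {seq y} (cauchy x) (cauchy y))
  ; _*_     = λ x y → mkℝ (λ n → seq x n ℚ.* seq y n) (*-cauchy {seq x} {seq y} (cauchy x) (cauchy y))
  ; -_      = λ x → mkℝ (λ n → ℚ.- seq x n) (neg-cauchy {seq x} (cauchy x))
  ; 0#      = fromℚ 0ℚ
  ; 1#      = fromℚ 1ℚ
  }

open RawRing ℝ-rawRing public using (_+_; _*_; -_; 0#; 1#)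
open RawSemiringDefinitions (RawRing.rawSemiring ℝ-rawRing) public using (product; _^_)

infixl 6 _-_

_-_ : ℝ → ℝ → ℝ
x - y = x + (- y)

ℝ^-setoid : ℕ → Setoid 0ℓ 0ℓ
ℝ^-setoid = VectorEquality.≋-setoid ℝ-setoid

-- Points are counted up to coordinatewise equality of real numbers.
HasCardinality : ∀ {m} → Pred (Vector ℝ m) 0ℓ → ℕ → Set
HasCardinality {m} P n =
  Bijection (≡.setoid (Fin n)) (On.setoid (ℝ^-setoid m) (proj₁ {B = P}))

words : ∀ n k → List (Vec (Fin n) k)
words n zero    = Vec.[] ∷ []
words n (suc k) = cartesianProductWith Vec._∷_ (allFin n) (words n k)

-- The j-th entry of a profile is the index 0 or 1 of the pure strategy
-- of player j.
PureProfile : ℕ → Set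
PureProfile m = Vec (Fin 2) m

Game : ℕ → Set
Game m = Fin m → PureProfile m → ℝ

prob : ℝ → Fin 2 → ℝ
prob γ zero    = 1# - γ
prob γ (suc _) = γ

expectedUtility : ∀ {m} → Game m → Fin m → Vector ℝ m → ℝ
expectedUtility {m} U i γ =
  foldr _+_ 0# (map (λ s → product (λ k → prob (γ k) (lookup s k)) * U i s) (words 2 m))

-- λⁱ(γ⁻ⁱ); it takes all of γ but overwrites the i-th coordinate.
gain : ∀ {m} → Game m → Fin m → Vector ℝ m → ℝ
gain U i γ =
  expectedUtility U i (updateAt γ i (const 1#)) - expectedUtility U i (updateAt γ i (const 0#))

Cube : ∀ {m} → Pred (Vector ℝ m) 0ℓ
Cube γ = ∀ i → 0# ≤ γ i × γ i ≤ 1#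

EquilibriumCandidate : ∀ {m} → Game m → Pred (Vector ℝ m) 0ℓ
EquilibriumCandidate U γ =
  Cube γ × (∀ i → 0# < γ i → γ i < 1# → gain U i γ ≈ 0#)

L₀ L₁ L : ∀ {m} → Vector ℝ m → Pred (Fin m) 0ℓ
L₀ γ i = γ i ≈ 0#
L₁ γ i = γ i ≈ 1#
L γ = L₀ γ ∪ L₁ γ

-- `a i j` stands for aⁱⱼ. Its diagonal values `a i i` are junk: nothing
-- is assumed about them and they are never used. The last clause is an
-- identity of polynomials in γ⁻ⁱ, hence quantified over all of ℝᵐ; the
-- product over j ≠ i is taken over all j with the factor at j = i set to 1.
IsProductGame : ∀ {m} → Game m → (Fin m → Fin 2) → (Fin m → Fin m → ℝ) → Set
IsProductGame U v a =
  (∀ i j → i ≢ j → 0# < a i j × a i j < 1#) ×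
  (∀ i₁ i₂ j → i₁ ≢ i₂ → i₁ ≢ j → i₂ ≢ j → a i₁ j ≉ a i₂ j) ×
  (∀ i γ → gain U i γ ≈
    (- 1#) ^ toℕ (v i) * product (λ j → if does (j ≟ i) then 1# else (γ j - a i j)))

F : ∀ {m} → Permutation′ m → Subset m
F π = tabulate (λ i → does (π ⟨$⟩ʳ i ≟ i))

EC : ∀ {m} → (Fin m → Fin m → ℝ) → Permutation′ m → Pred (Vector ℝ m) 0ℓ
EC a π γ = Cube γ × (L γ ≐ (_∈ F π)) × (∀ j → j ∉ F π → γ j ≈ a (π ⟨$⟩ʳ j) j)

-- A permutation of Fin n is given here by its table of values.
IsDerangement : ∀ {n} → Pred (Vec (Fin n) n) 0ℓ
IsDerangement v = Bijective _≡_ _≡_ (lookup v) × (∀ i → lookup v i ≢ i)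

isDerangement? : ∀ {n} → Decidable (IsDerangement {n})
isDerangement? v = (injective? ×-dec surjective?) ×-dec all? (λ i → ¬? (lookup v i ≟ i))
  where
  injective? : Dec (Injective _≡_ _≡_ (lookup v))
  injective? = map′ (λ h {x} {y} → h x y) (λ h x y → h {x} {y})
    (all? λ x → all? λ y → (lookup v x ≟ lookup v y) →-dec (x ≟ y))
  surjective? : Dec (Surjective _≡_ _≡_ (lookup v))
  surjective? = map′
    (λ h y → proj₁ (h y) , λ { refl → proj₂ (h y) })
    (λ h y → proj₁ (h y) , proj₂ (h y) refl)
    (all? λ y → any? λ x → lookup v x ≟ y)

infix 9 !_

!_ : ℕ → ℕ
! n = length (filter isDerangement? (words n n))

V : ℕ → ℕ
V m = sum (map (λ l → (m C l) ℕ.* 2 ℕ.^ l ℕ.* ! (m ℕ.∸ l)) (upTo (suc m)))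

{-# OPTIONS --safe #-}

-- At a candidate γ, every i with 0 < γⁱ < 1 has λⁱ = 0, so some j ≠ i satisfies
-- γʲ = aⁱⱼ; then 0 < γʲ < 1 as well, and since the aⁱⱼ with fixed j are distinct,
-- i ↦ j is an injection of the complement of L(γ) into itself. It is therefore a
-- permutation without fixed points there, and π is its inverse, extended by the
-- identity on L(γ). Conversely γ is determined by the set S = F(π), the values 0 or 1
-- on S, and the derangement induced by π on the complement of S, which gives
-- Σ_S 2^∣S∣ · !∣∁S∣ candidates; grouping the subsets S by size yields V(m).
module Submission where

open import Axiom.ExcludedMiddle using (ExcludedMiddle)
open import Data.Bool using (if_then_else_)
open import Data.Fin using (Fin; zero; suc; toℕ; combine; finToFun; funToFin; punchOut)
open import Data.Fin.Permutation using (Permutation′; permutation; _⟨$⟩ʳ_; _⟨$⟩ˡ_; inverseˡ; inverseʳ) renaming (_≈_ to _≈ₚ_)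
open import Data.Fin.Properties using (_≟_; any?; suc-injective; punchOut-injective; injective⇒≤; +↔⊎; *↔×; funToFin-finToFin; finToFun-funToFin)
open import Data.Fin.Subset using (Subset; inside; outside; _∈_; _∉_; ∁; ∣_∣)
open import Data.Fin.Subset.Properties using (_∈?_; ⊆-antisym; x∉p⇒x∈∁p; x∈∁p⇒x∉p)
import Data.List as List
open import Data.List using (List; applyUpTo; filter)
import Data.List.Membership.Propositional as List
open import Data.List.Membership.Propositional.Properties using (∈-lookup; ∈-filter⁺; ∈-filter⁻; ∈-allFin; ∈-cartesianProductWith⁺)
open import Data.List.Properties using (map-upTo)
import Data.List.Relation.Unary.All as All
open import Data.List.Relation.Unary.AllPairs using ([]; _∷_)
open import Data.List.Relation.Unary.Any using (index; here)
open import Data.List.Relation.Unary.Any.Properties using (lookup-index)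
open import Data.List.Relation.Unary.Unique.Propositional using (Unique)
import Data.List.Relation.Unary.Unique.Propositional.Properties as Unique
import Data.Nat as ℕ
open import Data.Nat using (ℕ)
open import Data.Nat.Combinatorics using (_C_; k>n⇒nCk≡0; nCk+nC[k+1]≡[n+1]C[k+1])
open import Data.Nat.ListAction using (sum)
import Data.Nat.Properties as ℕ
open import Data.Nat.Tactic.RingSolver using (solve-∀)
import Data.Product as Product
open import Data.Product using (Σ-syntax; _×_; _,_; proj₁; proj₂; ∃-syntax)
import Data.Rational as ℚ
open import Data.Rational using (ℚ; 0ℚ; 1ℚ; ½) renaming (∣_∣ to ∣_∣ℚ)
import Data.Rational.Properties as ℚ
open import Data.Rational.Solver using (module +-*-Solver)
import Data.Sum as Sum
open import Data.Sum using (_⊎_; inj₁; inj₂; [_,_]′)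
open import Data.Sum.Function.Propositional using (_⊎-↔_)
open import Data.Vec using (Vec; []; _∷_; here; there; lookup; tabulate)
open import Data.Vec.Functional using (Vector; foldr)
open import Data.Vec.Properties using (∷-injective; lookup∘tabulate; tabulate∘lookup; tabulate-cong; []=⇒lookup; lookup⇒[]=)
open import Function using (_∘_; _↔_; mk↔ₛ′; Inverse)
open import Function.Construct.Composition using (_↔-∘_)
open import Function.Definitions using (Injective)
open import Level using (0ℓ)
import Relation.Binary.PropositionalEquality as ≡
open import Relation.Binary.PropositionalEquality using (_≡_; _≢_; refl; cong; cong₂; subst; module ≡-Reasoning)
open import Relation.Nullary using (¬_; Dec; does; yes; no; contradiction)
open import Relation.Nullary.Decidable using (dec-true; dec-false; decidable-stable)
open import Relation.Unary using (Pred; _⊆_; _≐_; _⊥_; ⋃)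
open import Defs

-- Real numbers

0<½* : ∀ {ε} → 0ℚ ℚ.< ε → 0ℚ ℚ.< ½ ℚ.* ε
0<½* {ε} ε>0 = ℚ.positive⁻¹ (½ ℚ.* ε) {{ℚ.pos*pos⇒pos ½ ε {{ℚ.positive ε>0}}}}

½*+½* : ∀ ε → ½ ℚ.* ε ℚ.+ ½ ℚ.* ε ≡ ε
½*+½* ε = ≡.trans (≡.sym (ℚ.*-distribʳ-+ ε ½ ½)) (ℚ.*-identityˡ ε)

p≤∣p∣ : ∀ p → p ℚ.≤ ∣ p ∣ℚ
p≤∣p∣ p with ℚ.≤-total 0ℚ p
... | inj₁ 0≤p = ℚ.≤-reflexive (≡.sym (ℚ.0≤p⇒∣p∣≡p 0≤p))
... | inj₂ p≤0 = ℚ.≤-trans p≤0 (ℚ.0≤∣p∣ p)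

q+[p-q]≡p : ∀ p q → q ℚ.+ (p ℚ.- q) ≡ p
q+[p-q]≡p = solve 2 (λ p q → q :+ (p :- q) := p) refl
  where open +-*-Solver

p≤q+∣p-q∣ : ∀ p q → p ℚ.≤ q ℚ.+ ∣ p ℚ.- q ∣ℚ
p≤q+∣p-q∣ p q =
  subst (ℚ._≤ q ℚ.+ ∣ p ℚ.- q ∣ℚ) (q+[p-q]≡p p q) (ℚ.+-monoʳ-≤ q (p≤∣p∣ (p ℚ.- q)))

∣p∣≤∣q∣+∣p-q∣ : ∀ p q → ∣ p ∣ℚ ℚ.≤ ∣ q ∣ℚ ℚ.+ ∣ p ℚ.- q ∣ℚ
∣p∣≤∣q∣+∣p-q∣ p q =
  subst (λ r → ∣ r ∣ℚ ℚ.≤ ∣ q ∣ℚ ℚ.+ ∣ p ℚ.- q ∣ℚ) (q+[p-q]≡p p q) (ℚ.∣p+q∣≤∣p∣+∣q∣ q (p ℚ.- q))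

+-cancelʳ-≤ : ∀ r {p q} → p ℚ.+ r ℚ.≤ q ℚ.+ r → p ℚ.≤ q
+-cancelʳ-≤ r p+r≤q+r = ℚ.≮⇒≥ λ q<p →
  ℚ.<-irrefl refl (ℚ.<-≤-trans (ℚ.+-monoˡ-< r q<p) p+r≤q+r)

-- Half of the gap is given up to absorb the eventual distance between `y` and `z`; the other half
-- remains as the new gap.
<-respʳ-≈ : ∀ {x y z} → y ≈ z → x < y → x < z
<-respʳ-≈ {x} {y} {z} y≈z x<y =
  let (N , h) = null y≈z _ (0<½* (gap>0 x<y))
  in mk< (½ ℚ.* gap x<y) (0<½* (gap>0 x<y)) (from x<y ℕ.⊔ N) λ n n≥ →
    +-cancelʳ-≤ (½ ℚ.* gap x<y) (begin
      seq x n ℚ.+ ½ ℚ.* gap x<y ℚ.+ ½ ℚ.* gap x<y   ≡⟨ ℚ.+-assoc (seq x n) _ _ ⟩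
      seq x n ℚ.+ (½ ℚ.* gap x<y ℚ.+ ½ ℚ.* gap x<y) ≡⟨ cong (seq x n ℚ.+_) (½*+½* (gap x<y)) ⟩
      seq x n ℚ.+ gap x<y                           ≤⟨ apart x<y n (ℕ.m⊔n≤o⇒m≤o _ N n≥) ⟩
      seq y n                                       ≤⟨ p≤q+∣p-q∣ (seq y n) (seq z n) ⟩
      seq z n ℚ.+ ∣ seq y n ℚ.- seq z n ∣ℚ           ≤⟨ ℚ.+-monoʳ-≤ (seq z n) (ℚ.<⇒≤ (h n (ℕ.m⊔n≤o⇒n≤o (from x<y) N n≥))) ⟩
      seq z n ℚ.+ ½ ℚ.* gap x<y                     ∎)
  where open ℚ.≤-Reasoning

<-respˡ-≈ : ∀ {x y z} → x ≈ z → x < y → z < y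
<-respˡ-≈ {x} {y} {z} x≈z x<y =
  let (N , h) = null (≈-sym x≈z) _ (0<½* (gap>0 x<y))
  in mk< (½ ℚ.* gap x<y) (0<½* (gap>0 x<y)) (from x<y ℕ.⊔ N) λ n n≥ → begin
      seq z n ℚ.+ ½ ℚ.* gap x<y
        ≤⟨ ℚ.+-monoˡ-≤ _ (p≤q+∣p-q∣ (seq z n) (seq x n)) ⟩
      seq x n ℚ.+ ∣ seq z n ℚ.- seq x n ∣ℚ ℚ.+ ½ ℚ.* gap x<y
        ≤⟨ ℚ.+-monoˡ-≤ _ (ℚ.+-monoʳ-≤ (seq x n) (ℚ.<⇒≤ (h n (ℕ.m⊔n≤o⇒n≤o (from x<y) N n≥)))) ⟩
      seq x n ℚ.+ ½ ℚ.* gap x<y ℚ.+ ½ ℚ.* gap x<y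
        ≡⟨ ℚ.+-assoc (seq x n) _ _ ⟩
      seq x n ℚ.+ (½ ℚ.* gap x<y ℚ.+ ½ ℚ.* gap x<y)
        ≡⟨ cong (seq x n ℚ.+_) (½*+½* (gap x<y)) ⟩
      seq x n ℚ.+ gap x<y
        ≤⟨ apart x<y n (ℕ.m⊔n≤o⇒m≤o _ N n≥) ⟩
      seq y n ∎
  where open ℚ.≤-Reasoning

<-irrefl : ∀ {x} → ¬ (x < x)
<-irrefl {x} x<x = ℚ.<-irrefl refl (begin-strict
  seq x n               ≡⟨ ℚ.+-identityʳ (seq x n) ⟨
  seq x n ℚ.+ 0ℚ        <⟨ ℚ.+-monoʳ-< (seq x n) (gap>0 x<x) ⟩
  seq x n ℚ.+ gap x<x   ≤⟨ apart x<x n ℕ.≤-refl ⟩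
  seq x n               ∎)
  where
  open ℚ.≤-Reasoning
  n = from x<x

<⇒≉ : ∀ {x y} → x < y → x ≉ y
<⇒≉ x<y x≈y = <-irrefl (<-respˡ-≈ x≈y x<y)

0<1 : 0# < 1#
0<1 = mk< 1ℚ (ℚ.positive⁻¹ 1ℚ) 0 λ _ _ → ℚ.≤-refl

-- Null sequences and zeros of products

Null : (ℕ → ℚ) → Set
Null x = ∀ ε → 0ℚ ℚ.< ε → ∃[ N ] ∀ n → N ℕ.≤ n → ∣ x n ∣ℚ ℚ.< ε

≈0⇒Null : ∀ {x} → x ≈ 0# → Null (seq x)
≈0⇒Null {x} x≈0 ε ε>0 =
  let (N , h) = null x≈0 ε ε>0
  in N , λ n n≥ → subst (λ p → ∣ p ∣ℚ ℚ.< ε) (ℚ.+-identityʳ (seq x n)) (h n n≥)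

Null⇒≈0 : ∀ {x} → Null (seq x) → x ≈ 0#
Null⇒≈0 {x} h = mk≈ λ ε ε>0 →
  let (N , f) = h ε ε>0
  in N , λ n n≥ → subst (λ p → ∣ p ∣ℚ ℚ.< ε) (≡.sym (ℚ.+-identityʳ (seq x n))) (f n n≥)

x-y≈0⇒x≈y : ∀ {x y} → x - y ≈ 0# → x ≈ y
x-y≈0⇒x≈y {x} {y} h = mk≈ (≈0⇒Null {x - y} h)

x≈y⇒x-y≈0 : ∀ {x y} → x ≈ y → x - y ≈ 0#
x≈y⇒x-y≈0 {x} {y} h = Null⇒≈0 {x - y} (null h)

divide : ∀ {B ε} → 0ℚ ℚ.< B → 0ℚ ℚ.< ε → ∃[ δ ] 0ℚ ℚ.< δ × B ℚ.* δ ≡ ε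
divide {B} {ε} B>0 ε>0 =
  1/B ℚ.* ε ,
  ℚ.positive⁻¹ (1/B ℚ.* ε) {{ℚ.pos*pos⇒pos 1/B {{ℚ.1/pos⇒pos B {{posB}}}} ε {{ℚ.positive ε>0}}}} ,
  ≡.trans (≡.sym (ℚ.*-assoc B 1/B ε))
    (≡.trans (cong (ℚ._* ε) (ℚ.*-inverseʳ B {{nzB}})) (ℚ.*-identityˡ ε))
  where
  posB = ℚ.positive B>0
  nzB  = ℚ.pos⇒nonZero B {{posB}}
  1/B  = ℚ.1/_ B {{nzB}}

eventually-bounded : ∀ x → ∃[ B ] 0ℚ ℚ.< B × ∃[ N ] ∀ n → N ℕ.≤ n → ∣ seq x n ∣ℚ ℚ.≤ B
eventually-bounded x =
  let (N , f) = cauchy x 1ℚ (ℚ.positive⁻¹ 1ℚ)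
  in ∣ seq x N ∣ℚ ℚ.+ 1ℚ , ℚ.+-mono-≤-< (ℚ.0≤∣p∣ (seq x N)) (ℚ.positive⁻¹ 1ℚ) , N , λ n n≥ →
    ℚ.≤-trans (∣p∣≤∣q∣+∣p-q∣ (seq x n) (seq x N))
      (ℚ.+-monoʳ-≤ ∣ seq x N ∣ℚ (ℚ.<⇒≤ (f n N n≥ ℕ.≤-refl)))

-- The sequence of `x` is eventually bounded by some `B`, so it suffices to push `y` below ε / B.
*-zeroʳ-≈ : ∀ x {y} → y ≈ 0# → x * y ≈ 0#
*-zeroʳ-≈ x {y} y≈0 = Null⇒≈0 {x * y} λ ε ε>0 →
  let (B , B>0 , M , f) = eventually-bounded x
      (δ , δ>0 , B*δ≡ε) = divide {B} {ε} B>0 ε>0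
      (N , g) = ≈0⇒Null {y} y≈0 δ δ>0
  in M ℕ.⊔ N , λ n n≥ → begin-strict
    ∣ seq x n ℚ.* seq y n ∣ℚ
      ≡⟨ ℚ.∣p*q∣≡∣p∣*∣q∣ (seq x n) (seq y n) ⟩
    ∣ seq x n ∣ℚ ℚ.* ∣ seq y n ∣ℚ
      ≤⟨ ℚ.*-monoʳ-≤-nonNeg ∣ seq y n ∣ℚ {{ℚ.∣-∣-nonNeg (seq y n)}} (f n (ℕ.m⊔n≤o⇒m≤o M N n≥)) ⟩
    B ℚ.* ∣ seq y n ∣ℚ
      <⟨ ℚ.*-monoʳ-<-pos B {{ℚ.positive B>0}} (g n (ℕ.m⊔n≤o⇒n≤o M N n≥)) ⟩
    B ℚ.* δ
      ≡⟨ B*δ≡ε ⟩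
    ε ∎
  where open ℚ.≤-Reasoning

*-comm-≈ : ∀ x y → x * y ≈ y * x
*-comm-≈ x y = mk≈ λ ε ε>0 → 0 , λ n _ →
  subst (ℚ._< ε) (cong ∣_∣ℚ (≡.sym (≡.trans
    (cong (ℚ._- (seq y n ℚ.* seq x n)) (ℚ.*-comm (seq x n) (seq y n))) (ℚ.+-inverseʳ (seq y n ℚ.* seq x n))))) ε>0

*-zeroˡ-≈ : ∀ {x} y → x ≈ 0# → x * y ≈ 0#
*-zeroˡ-≈ {x} y x≈0 = ≈-trans {x * y} {y * x} {0#} (*-comm-≈ x y) (*-zeroʳ-≈ y {x} x≈0)

-- A positive form of being nonzero: an eventual rational lower bound, by which one can divide.
AwayFromZero : ℝ → Set
AwayFromZero x = ∃[ δ ] 0ℚ ℚ.< δ × ∃[ N ] ∀ n → N ℕ.≤ n → δ ℚ.≤ ∣ seq x n ∣ℚ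

-- One term of size at least ε beyond the Cauchy index for ε/2 keeps every term beyond that index at
-- size at least ε/2, so `x` would be away from zero.
¬awayFromZero⇒≈0 : ∀ {x} → ¬ AwayFromZero x → x ≈ 0#
¬awayFromZero⇒≈0 {x} ¬away = Null⇒≈0 {x} λ ε ε>0 →
  let (N , f) = cauchy x _ (0<½* ε>0)
  in N , λ n n≥ → ℚ.≰⇒> λ ε≤∣xₙ∣ → ¬away
    (½ ℚ.* ε , 0<½* ε>0 , N , λ k k≥ → +-cancelʳ-≤ (½ ℚ.* ε) (begin
      ½ ℚ.* ε ℚ.+ ½ ℚ.* ε                       ≡⟨ ½*+½* ε ⟩
      ε                                         ≤⟨ ε≤∣xₙ∣ ⟩
      ∣ seq x n ∣ℚ                               ≤⟨ ∣p∣≤∣q∣+∣p-q∣ (seq x n) (seq x k) ⟩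
      ∣ seq x k ∣ℚ ℚ.+ ∣ seq x n ℚ.- seq x k ∣ℚ   ≤⟨ ℚ.+-monoʳ-≤ ∣ seq x k ∣ℚ (ℚ.<⇒≤ (f n k n≥ k≥)) ⟩
      ∣ seq x k ∣ℚ ℚ.+ ½ ℚ.* ε                   ∎))
  where open ℚ.≤-Reasoning

-- Where the terms of `x` have size at least δ, a product of size below δε forces the factor from
-- `y` below ε.
awayFromZero-cancelˡ : ∀ {x y} → AwayFromZero x → x * y ≈ 0# → y ≈ 0#
awayFromZero-cancelˡ {x} {y} (δ , δ>0 , M , f) xy≈0 = Null⇒≈0 {y} λ ε ε>0 →
  let δ⁺ = ℚ.positive δ>0
      (N , g) = ≈0⇒Null {x * y} xy≈0 (δ ℚ.* ε)
                  (ℚ.positive⁻¹ _ {{ℚ.pos*pos⇒pos δ {{δ⁺}} ε {{ℚ.positive ε>0}}}})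
  in M ℕ.⊔ N , λ n n≥ → ℚ.*-cancelˡ-<-nonNeg δ {{ℚ.pos⇒nonNeg δ {{δ⁺}}}} (begin-strict
    δ ℚ.* ∣ seq y n ∣ℚ
      ≤⟨ ℚ.*-monoʳ-≤-nonNeg ∣ seq y n ∣ℚ {{ℚ.∣-∣-nonNeg (seq y n)}} (f n (ℕ.m⊔n≤o⇒m≤o M N n≥)) ⟩
    ∣ seq x n ∣ℚ ℚ.* ∣ seq y n ∣ℚ
      ≡⟨ ℚ.∣p*q∣≡∣p∣*∣q∣ (seq x n) (seq y n) ⟨
    ∣ seq x n ℚ.* seq y n ∣ℚ
      <⟨ g n (ℕ.m⊔n≤o⇒n≤o M N n≥) ⟩
    δ ℚ.* ε ∎)
  where open ℚ.≤-Reasoning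

foldr-absorbs : ∀ {A : Set} (P : Pred A 0ℓ) (_∙_ : A → A → A) (e : A) →
                (∀ x y → P x → P (x ∙ y)) → (∀ x y → P y → P (x ∙ y)) →
                ∀ {n} (x : Vector A n) i → P (x i) → P (foldr _∙_ e x)
foldr-absorbs P _∙_ e absˡ absʳ x zero    Px = absˡ _ _ Px
foldr-absorbs P _∙_ e absˡ absʳ x (suc i) Px = absʳ _ _ (foldr-absorbs P _∙_ e absˡ absʳ (x ∘ suc) i Px)

-- `P` behaves like a prime ideal avoiding `e`. Taken with `_≈ 0#`, it says that a vanishing product
-- has a vanishing factor.
foldr-prime : ∀ {A : Set} (P : Pred A 0ℓ) (_∙_ : A → A → A) (e : A) →
              ¬ P e → (∀ x y → P (x ∙ y) → P x ⊎ P y) →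
              ∀ {n} (x : Vector A n) → P (foldr _∙_ e x) → ∃[ i ] P (x i)
foldr-prime P _∙_ e ¬Pe prime {ℕ.zero} x Pe = contradiction Pe ¬Pe
foldr-prime P _∙_ e ¬Pe prime {ℕ.suc n} x Px with prime _ _ Px
... | inj₁ Px₀ = zero , Px₀
... | inj₂ Pxs = let (i , Pxᵢ) = foldr-prime P _∙_ e ¬Pe prime (x ∘ suc) Pxs in suc i , Pxᵢ

product-zero⁺ : ∀ {n} (x : Vector ℝ n) i → x i ≈ 0# → product x ≈ 0#
product-zero⁺ = foldr-absorbs (_≈ 0#) _*_ 1# (λ x y → *-zeroˡ-≈ {x} y) (λ x y → *-zeroʳ-≈ x {y})

-- The only place where excluded middle is applied: it decides whether `x` is bounded away from
-- zero. If so, `x` can be cancelled; if not, `x` is null.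
x*y≈0⇒x≈0∨y≈0 : ExcludedMiddle 0ℓ → ∀ x y → x * y ≈ 0# → x ≈ 0# ⊎ y ≈ 0#
x*y≈0⇒x≈0∨y≈0 em x y xy≈0 = cases em
  where
  cases : Dec (AwayFromZero x) → x ≈ 0# ⊎ y ≈ 0#
  cases (yes away) = inj₂ (awayFromZero-cancelˡ {x} {y} away xy≈0)
  cases (no ¬away) = inj₁ (¬awayFromZero⇒≈0 {x} ¬away)

product-zero⁻ : ExcludedMiddle 0ℓ → ∀ {n} (x : Vector ℝ n) → product x ≈ 0# → ∃[ i ] x i ≈ 0#
product-zero⁻ em = foldr-prime (_≈ 0#) _*_ 1#
  (λ (1≈0 : 1# ≈ 0#) → <⇒≉ {0#} {1#} 0<1 (≈-sym {1#} {0#} 1≈0))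
  (x*y≈0⇒x≈0∨y≈0 em)

signℚ : Fin 2 → ℚ
signℚ zero    = 1ℚ
signℚ (suc _) = ℚ.- 1ℚ

signℚ-awayFromZero : ∀ v → AwayFromZero (fromℚ (signℚ v))
signℚ-awayFromZero zero       = 1ℚ , ℚ.positive⁻¹ 1ℚ , 0 , λ _ _ → ℚ.≤-refl
signℚ-awayFromZero (suc zero) = 1ℚ , ℚ.positive⁻¹ 1ℚ , 0 , λ _ _ → ℚ.≤-refl

-- These take the sequence form of g ≈ s * p: comparing two occurrences of a
-- product of reals would make the type checker unfold its Cauchy proof.
≈*-zero⁺ : ∀ g s p → Null (λ n → seq g n ℚ.- seq s n ℚ.* seq p n) → p ≈ 0# → g ≈ 0#
≈*-zero⁺ g s p g≈sp p≈0 = ≈-trans {g} {s * p} {0#} (mk≈ g≈sp) (*-zeroʳ-≈ s {p} p≈0)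

≈*-zero⁻ : ∀ g s p → AwayFromZero s → Null (λ n → seq g n ℚ.- seq s n ℚ.* seq p n) →
           g ≈ 0# → p ≈ 0#
≈*-zero⁻ g s p away g≈sp g≈0 =
  awayFromZero-cancelˡ {s} {p} away (≈-trans {s * p} {g} {0#} (≈-sym {g} {s * p} (mk≈ g≈sp)) g≈0)

factor-zero⁺ : ∀ {A : Set} (d : Dec A) (x y : ℝ) → ¬ A → x ≈ y → (if does d then 1# else (x - y)) ≈ 0#
factor-zero⁺ (yes A) x y ¬A x≈y = contradiction A ¬A
factor-zero⁺ (no _)  x y ¬A x≈y = x≈y⇒x-y≈0 {x} {y} x≈y

factor-zero⁻ : ∀ {A : Set} (d : Dec A) (x y : ℝ) → (if does d then 1# else (x - y)) ≈ 0# → ¬ A × x ≈ y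
factor-zero⁻ (yes _) x y 1≈0   = contradiction (≈-sym {1#} {0#} 1≈0) (<⇒≉ {0#} {1#} 0<1)
factor-zero⁻ (no ¬A) x y x-y≈0 = ¬A , x-y≈0⇒x≈y {x} {y} x-y≈0

-- The same expression as in IsProductGame: a bare definition, so that the two are
-- recognised as equal without unfolding any Cauchy proof.
module _ {m} (a γ : Vector ℝ m) (i : Fin m) where

  IsSignedProduct : Fin 2 → ℝ → Set
  IsSignedProduct v g = g ≈
    (- 1#) ^ toℕ v * product (λ j → if does (j ≟ i) then 1# else (γ j - a j))

  factor : Vector ℝ m
  factor j = if does (j ≟ i) then 1# else (γ j - a j)

  -- Once `v` is split, the power of -1 computes to the constant sequence `signℚ v`, so the given
  -- null sequence already has the required form.
  signedProduct-null : ∀ v {g} → IsSignedProduct v g →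
                       Null (λ n → seq g n ℚ.- signℚ v ℚ.* seq (product factor) n)
  signedProduct-null zero       g≈ = null g≈
  signedProduct-null (suc zero) g≈ = null g≈

  signedProduct-zero⁺ : ∀ {v g} → IsSignedProduct v g → ∀ {j} → j ≢ i → γ j ≈ a j → g ≈ 0#
  signedProduct-zero⁺ {v} {g} g≈ {j} j≢i γⱼ≈aⱼ =
    ≈*-zero⁺ g (fromℚ (signℚ v)) (product factor) (signedProduct-null v {g} g≈)
      (product-zero⁺ factor j (factor-zero⁺ (j ≟ i) (γ j) (a j) j≢i γⱼ≈aⱼ))

  signedProduct-zero⁻ : ExcludedMiddle 0ℓ → ∀ {v g} → IsSignedProduct v g →
                        g ≈ 0# → ∃[ j ] j ≢ i × γ j ≈ a j
  signedProduct-zero⁻ em {v} {g} g≈ g≈0 =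
    Product.map₂ (λ {j} → factor-zero⁻ (j ≟ i) (γ j) (a j)) (product-zero⁻ em factor
      (≈*-zero⁻ g (fromℚ (signℚ v)) (product factor) (signℚ-awayFromZero v)
        (signedProduct-null v {g} g≈) g≈0))

-- Subsets, binomial sums and derangements

-- The increasing enumeration of `S`, with inverse `position`. It transports bit words and
-- derangements between a subset and an initial segment.
elem : ∀ {m} (S : Subset m) → Fin ∣ S ∣ → Fin m
elem (inside  ∷ S) zero    = zero
elem (inside  ∷ S) (suc p) = suc (elem S p)
elem (outside ∷ S) p       = suc (elem S p)

elem∈ : ∀ {m} (S : Subset m) p → elem S p ∈ S
elem∈ (inside  ∷ S) zero    = here
elem∈ (inside  ∷ S) (suc p) = there (elem∈ S p)
elem∈ (outside ∷ S) p       = there (elem∈ S p)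

elem-injective : ∀ {m} (S : Subset m) {p q} → elem S p ≡ elem S q → p ≡ q
elem-injective (inside  ∷ S) {zero}  {zero}  _  = refl
elem-injective (inside  ∷ S) {suc p} {suc q} eq = cong suc (elem-injective S (suc-injective eq))
elem-injective (outside ∷ S)                 eq = elem-injective S (suc-injective eq)

position : ∀ {m} {S : Subset m} {j} → j ∈ S → Fin ∣ S ∣
position {S = inside  ∷ S} here      = zero
position {S = inside  ∷ S} (there q) = suc (position q)
position {S = outside ∷ S} (there q) = position q

elem-position : ∀ {m} {S : Subset m} {j} (j∈S : j ∈ S) → elem S (position j∈S) ≡ j
elem-position {S = inside  ∷ S} here      = refl
elem-position {S = inside  ∷ S} (there q) = cong suc (elem-position q)
elem-position {S = outside ∷ S} (there q) = cong suc (elem-position q)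

position-elem : ∀ {m} (S : Subset m) {p} (q : elem S p ∈ S) → position q ≡ p
position-elem S q = elem-injective S (elem-position q)

-- Pigeonhole: a missed value could be punched out of the codomain, leaving an injection from n+1
-- elements into n.
injective⇒section : ∀ {n} {f : Fin n → Fin n} → Injective _≡_ _≡_ f → ∀ y → ∃[ x ] f x ≡ y
injective⇒section {ℕ.suc n} {f} f-inj y with any? (λ x → f x ≟ y)
... | yes hit = hit
... | no miss = contradiction
  (injective⇒≤ {f = λ x → punchOut (avoid x)} (λ {x} {x′} → f-inj ∘ punchOut-injective (avoid x) (avoid x′)))
  ℕ.1+n≰n
  where
  avoid : ∀ x → y ≢ f x
  avoid x y≡fx = miss (x , ≡.sym y≡fx)

-- Sums over subsets grouped by size

Σ< : ℕ → (ℕ → ℕ) → ℕ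
Σ< n f = sum (applyUpTo f n)

Σ<-cong : ∀ n {f g} → (∀ l → l ℕ.< n → f l ≡ g l) → Σ< n f ≡ Σ< n g
Σ<-cong ℕ.zero    f≗g = refl
Σ<-cong (ℕ.suc n) f≗g = cong₂ ℕ._+_ (f≗g 0 ℕ.z<s) (Σ<-cong n λ l l<n → f≗g (ℕ.suc l) (ℕ.s<s l<n))

Σ<-+ : ∀ n f g → Σ< n (λ l → f l ℕ.+ g l) ≡ Σ< n f ℕ.+ Σ< n g
Σ<-+ ℕ.zero    f g = refl
Σ<-+ (ℕ.suc n) f g =
  ≡.trans (cong (f 0 ℕ.+ g 0 ℕ.+_) (Σ<-+ n (f ∘ ℕ.suc) (g ∘ ℕ.suc)))
    (interchange (f 0) (g 0) (Σ< n (f ∘ ℕ.suc)) (Σ< n (g ∘ ℕ.suc)))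
  where
  interchange : ∀ a b c d → a ℕ.+ b ℕ.+ (c ℕ.+ d) ≡ a ℕ.+ c ℕ.+ (b ℕ.+ d)
  interchange = solve-∀

Σ<-last : ∀ n f → Σ< (ℕ.suc n) f ≡ Σ< n f ℕ.+ f n
Σ<-last ℕ.zero    f = ℕ.+-identityʳ (f 0)
Σ<-last (ℕ.suc n) f = ≡.trans (cong (f 0 ℕ.+_) (Σ<-last n (f ∘ ℕ.suc))) (≡.sym (ℕ.+-assoc (f 0) _ _))

-- The sum of w ∣S∣ ∣∁S∣ over all subsets S of Fin m.
subsetSum : (m : ℕ) → (ℕ → ℕ → ℕ) → ℕ
subsetSum ℕ.zero    w = w 0 0
subsetSum (ℕ.suc m) w = subsetSum m (w ∘ ℕ.suc) ℕ.+ subsetSum m (λ l k → w l (ℕ.suc k))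

-- The two summands correspond to whether `S` contains the first index, which raises the size of `S`
-- or of its complement by one.
subsetSum↔ : ∀ m w → Fin (subsetSum m w) ↔ (Σ[ S ∈ Subset m ] Fin (w ∣ S ∣ ∣ ∁ S ∣))
subsetSum↔ ℕ.zero    w = mk↔ₛ′ ([] ,_) (λ { ([] , x) → x }) (λ { ([] , x) → refl }) (λ _ → refl)
subsetSum↔ (ℕ.suc m) w =
  mk↔ₛ′
    [ (λ { (S , x) → inside ∷ S , x }) , (λ { (S , x) → outside ∷ S , x }) ]′
    (λ { (inside ∷ S , x) → inj₁ (S , x) ; (outside ∷ S , x) → inj₂ (S , x) })
    (λ { (inside ∷ S , x) → refl ; (outside ∷ S , x) → refl })
    (λ { (inj₁ _) → refl ; (inj₂ _) → refl })
  ↔-∘ ((subsetSum↔ m (w ∘ ℕ.suc) ⊎-↔ subsetSum↔ m (λ l k → w l (ℕ.suc k))) ↔-∘ +↔⊎)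

binomialSum : ℕ → (ℕ → ℕ → ℕ) → ℕ
binomialSum m w = Σ< (ℕ.suc m) (λ l → (m C l) ℕ.* w l (m ℕ.∸ l))

-- Induction on `m` for all weights at once: Pascal's rule splits the binomial sum into two with
-- shifted weights, which is the recursion of `subsetSum`.
binomialSum≡subsetSum : ∀ m w → binomialSum m w ≡ subsetSum m w
binomialSum≡subsetSum ℕ.zero    w = ≡.trans (ℕ.+-identityʳ _) (ℕ.*-identityˡ (w 0 0))
binomialSum≡subsetSum (ℕ.suc m) w = begin
  first ℕ.+ Σ< (ℕ.suc m) (λ l → (ℕ.suc m C ℕ.suc l) ℕ.* w (ℕ.suc l) (m ℕ.∸ l))
    ≡⟨ cong (first ℕ.+_) (Σ<-cong (ℕ.suc m) λ l _ → ≡.trans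
         (cong (ℕ._* w (ℕ.suc l) (m ℕ.∸ l)) (≡.sym (nCk+nC[k+1]≡[n+1]C[k+1] m l)))
         (ℕ.*-distribʳ-+ (w (ℕ.suc l) (m ℕ.∸ l)) (m C l) (m C ℕ.suc l))) ⟩
  first ℕ.+ Σ< (ℕ.suc m) (λ l → f l ℕ.+ g (ℕ.suc l))
    ≡⟨ cong (first ℕ.+_) (Σ<-+ (ℕ.suc m) f (g ∘ ℕ.suc)) ⟩
  first ℕ.+ (Σ< (ℕ.suc m) f ℕ.+ Σ< (ℕ.suc m) (g ∘ ℕ.suc))
    -- `first` is `g 0`, so it completes the shifted sum to the sum of `g` over 0, ..., m+1.
    ≡⟨ swap first (Σ< (ℕ.suc m) f) (Σ< (ℕ.suc m) (g ∘ ℕ.suc)) ⟩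
  Σ< (ℕ.suc m) f ℕ.+ Σ< (ℕ.suc (ℕ.suc m)) g
    ≡⟨ cong (Σ< (ℕ.suc m) f ℕ.+_) (Σ<-last (ℕ.suc m) g) ⟩
  Σ< (ℕ.suc m) f ℕ.+ (Σ< (ℕ.suc m) g ℕ.+ g (ℕ.suc m))
    -- The surplus term at m+1 carries the binomial coefficient of m over m+1, which is 0.
    ≡⟨ cong (λ c → Σ< (ℕ.suc m) f ℕ.+ (Σ< (ℕ.suc m) g ℕ.+ c ℕ.* w (ℕ.suc m) (ℕ.suc m ℕ.∸ ℕ.suc m)))
         (k>n⇒nCk≡0 (ℕ.n<1+n m)) ⟩
  Σ< (ℕ.suc m) f ℕ.+ (Σ< (ℕ.suc m) g ℕ.+ 0)
    ≡⟨ cong (Σ< (ℕ.suc m) f ℕ.+_) (ℕ.+-identityʳ _) ⟩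
  Σ< (ℕ.suc m) f ℕ.+ Σ< (ℕ.suc m) g
    -- All remaining indices satisfy l ≤ m, so truncated subtraction commutes with the successor.
    ≡⟨ cong (Σ< (ℕ.suc m) f ℕ.+_) (Σ<-cong (ℕ.suc m) λ l l≤m →
         cong (λ k → (m C l) ℕ.* w l k) (ℕ.+-∸-assoc 1 (ℕ.s≤s⁻¹ l≤m))) ⟩
  binomialSum m (w ∘ ℕ.suc) ℕ.+ binomialSum m (λ l k → w l (ℕ.suc k))
    ≡⟨ cong₂ ℕ._+_ (binomialSum≡subsetSum m (w ∘ ℕ.suc)) (binomialSum≡subsetSum m (λ l k → w l (ℕ.suc k))) ⟩
  subsetSum (ℕ.suc m) w ∎
  where
  open ≡-Reasoning
  f g : ℕ → ℕ
  f l = (m C l) ℕ.* w (ℕ.suc l) (m ℕ.∸ l)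
  g l = (m C l) ℕ.* w l (ℕ.suc m ℕ.∸ l)
  first = g 0
  swap : ∀ a b c → a ℕ.+ (b ℕ.+ c) ≡ b ℕ.+ (a ℕ.+ c)
  swap = solve-∀

V≡subsetSum : (m : ℕ) → V m ≡ subsetSum m (λ l k → 2 ℕ.^ l ℕ.* ! k)
V≡subsetSum m = begin
  V m
    ≡⟨ cong sum (map-upTo _ (ℕ.suc m)) ⟩
  Σ< (ℕ.suc m) (λ l → (m C l) ℕ.* 2 ℕ.^ l ℕ.* ! (m ℕ.∸ l))
    ≡⟨ Σ<-cong (ℕ.suc m) (λ l _ → ℕ.*-assoc (m C l) (2 ℕ.^ l) (! (m ℕ.∸ l))) ⟩
  binomialSum m (λ l k → 2 ℕ.^ l ℕ.* ! k)
    ≡⟨ binomialSum≡subsetSum m (λ l k → 2 ℕ.^ l ℕ.* ! k) ⟩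
  subsetSum m (λ l k → 2 ℕ.^ l ℕ.* ! k) ∎
  where open ≡-Reasoning

-- The second component is read by `finToFun` as a 0/1 word on `S`, the third as an index into the
-- list of derangements of the complement.
Code : ℕ → Set
Code m = Σ[ S ∈ Subset m ] (Fin (2 ℕ.^ ∣ S ∣) × Fin (! ∣ ∁ S ∣))

V↔Code : ∀ m → Fin (V m) ↔ Code m
V↔Code m = subst (λ n → Fin n ↔ Code m) (≡.sym (V≡subsetSum m))
  (mk↔ₛ′ (λ (S , x) → S , Inverse.to *↔× x) (λ (S , x) → S , Inverse.from *↔× x)
         (λ (S , x) → cong (S ,_) (Inverse.inverseˡ *↔× refl))
         (λ (S , x) → cong (S ,_) (Inverse.inverseʳ (*↔× {2 ℕ.^ ∣ S ∣}) refl))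
   ↔-∘ subsetSum↔ m (λ l k → 2 ℕ.^ l ℕ.* ! k))

-- Enumeration of derangements

Unique⇒lookup-injective : ∀ {A : Set} {xs : List A} → Unique xs → Injective _≡_ _≡_ (List.lookup xs)
Unique⇒lookup-injective (x∉xs ∷ _)  {zero}  {zero}  _  = refl
Unique⇒lookup-injective (x∉xs ∷ _)  {zero}  {suc j} eq = contradiction eq (All.lookup x∉xs (∈-lookup j))
Unique⇒lookup-injective (x∉xs ∷ _)  {suc i} {zero}  eq = contradiction (≡.sym eq) (All.lookup x∉xs (∈-lookup i))
Unique⇒lookup-injective (_    ∷ xs!) {suc i} {suc j} eq = cong suc (Unique⇒lookup-injective xs! eq)

words-unique : ∀ n k → Unique (words n k)
words-unique n ℕ.zero    = All.[] ∷ []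
words-unique n (ℕ.suc k) =
  Unique.cartesianProductWith⁺ _∷_ ∷-injective (Unique.allFin⁺ n) (words-unique n k)

∈-words : ∀ {n k} (v : Vec (Fin n) k) → v List.∈ words n k
∈-words []      = here refl
∈-words (x ∷ v) = ∈-cartesianProductWith⁺ _∷_ (∈-allFin x) (∈-words v)

-- `! n` is by definition the length of this list, so `Fin (! n)` is exactly its type of positions.
derangement : ∀ {n} → Fin (! n) → Vec (Fin n) n
derangement {n} = List.lookup (filter isDerangement? (words n n))

derangement-isDerangement : ∀ {n} (d : Fin (! n)) → IsDerangement (derangement d)
derangement-isDerangement {n} d = proj₂ (∈-filter⁻ isDerangement? {xs = words n n} (∈-lookup d))

derangement-injective : ∀ {n} → Injective _≡_ _≡_ (derangement {n})
derangement-injective {n} = Unique⇒lookup-injective (Unique.filter⁺ isDerangement? (words-unique n n))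

derangement-surjective : ∀ {n} (v : Vec (Fin n) n) → IsDerangement v → ∃[ d ] derangement d ≡ v
derangement-surjective v v-der = index v∈ , ≡.sym (lookup-index v∈)
  where v∈ = ∈-filter⁺ isDerangement? (∈-words v) v-der

-- Candidates

interior⇒∉L : ∀ {x} → 0# < x → x < 1# → ¬ (x ≈ 0# ⊎ x ≈ 1#)
interior⇒∉L 0<x x<1 (inj₁ x≈0) = <⇒≉ 0<x (≈-sym x≈0)
interior⇒∉L 0<x x<1 (inj₂ x≈1) = <⇒≉ x<1 x≈1

bit : Fin 2 → ℝ
bit zero    = 0#
bit (suc _) = 1#

bit-inUnitInterval : ∀ b → 0# ≤ bit b × bit b ≤ 1#
bit-inUnitInterval zero    = inj₂ ≈-refl , inj₁ 0<1
bit-inUnitInterval (suc _) = inj₁ 0<1 , inj₂ ≈-refl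

bit-boundary : ∀ b → bit b ≈ 0# ⊎ bit b ≈ 1#
bit-boundary zero    = inj₁ ≈-refl
bit-boundary (suc _) = inj₂ ≈-refl

boundary⇒bit : ∀ {x} → x ≈ 0# ⊎ x ≈ 1# → ∃[ b ] bit b ≈ x
boundary⇒bit (inj₁ x≈0) = zero , ≈-sym x≈0
boundary⇒bit (inj₂ x≈1) = suc zero , ≈-sym x≈1

bit-injective : ∀ {b c} → bit b ≈ bit c → b ≡ c
bit-injective {zero}     {zero}     _   = refl
bit-injective {zero}     {suc zero} 0≈1 = contradiction 0≈1 (<⇒≉ 0<1)
bit-injective {suc zero} {zero}     1≈0 = contradiction (≈-sym 1≈0) (<⇒≉ 0<1)
bit-injective {suc zero} {suc zero} _   = refl

-- The decoded functions agree only pointwise, so `funToFin` is first shown to respect pointwise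
-- equality; then the round trip applies.
finToFun-injective : ∀ {m n} {c d : Fin (m ℕ.^ n)} → (∀ p → finToFun {m} {n} c p ≡ finToFun d p) → c ≡ d
finToFun-injective {m} {n} {c} {d} c≗d =
  ≡.trans (≡.sym (funToFin-finToFin {n} {m} c)) (≡.trans (funToFin-cong n c≗d) (funToFin-finToFin {n} {m} d))
  where
  funToFin-cong : ∀ n {f g : Fin n → Fin m} → (∀ p → f p ≡ g p) → funToFin f ≡ funToFin g
  funToFin-cong ℕ.zero    f≗g = refl
  funToFin-cong (ℕ.suc n) f≗g = cong₂ combine (f≗g zero) (funToFin-cong n (f≗g ∘ suc))

module _ {m} (a : Fin m → Fin m → ℝ) (S : Subset m) (c : Fin (2 ℕ.^ ∣ S ∣)) (ρ : Fin m → Fin m) where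

  coordinate : ∀ j → Dec (j ∈ S) → ℝ
  coordinate j (yes j∈S) = bit (finToFun c (position j∈S))
  coordinate j (no  _)   = a (ρ j) j

  point : Vector ℝ m
  point j = coordinate j (j ∈? S)

  point-∈ : ∀ {j} (j∈S : j ∈ S) → point j ≡ bit (finToFun c (position j∈S))
  point-∈ {j} j∈S = lemma (j ∈? S)
    where
    lemma : ∀ d → coordinate j d ≡ bit (finToFun c (position j∈S))
    -- The decision brings its own membership proof; injectivity of `elem` identifies the two
    -- positions.
    lemma (yes j∈S′) = cong (bit ∘ finToFun c)
      (elem-injective S (≡.trans (elem-position j∈S′) (≡.sym (elem-position j∈S))))
    lemma (no j∉S)   = contradiction j∈S j∉S

  point-∉ : ∀ {j} → j ∉ S → point j ≡ a (ρ j) j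
  point-∉ {j} j∉S = lemma (j ∈? S)
    where
    lemma : ∀ d → coordinate j d ≡ a (ρ j) j
    lemma (yes j∈S) = contradiction j∈S j∉S
    lemma (no  _)   = refl

-- EC a π is Box a (F π) π.
Box : ∀ {m} → (Fin m → Fin m → ℝ) → Subset m → (Fin m → Fin m) → Pred (Vector ℝ m) 0ℓ
Box a S ρ γ = Cube γ × (L γ ≐ (_∈ S)) × (∀ j → j ∉ S → γ j ≈ a (ρ j) j)

-- Together with `OntoOff`, this captures what boxes require of `ρ`, so that permutations and the
-- maps built from derangement indices are treated alike.
NoFixedPointOff : ∀ {m} → Subset m → (Fin m → Fin m) → Set
NoFixedPointOff S ρ = ∀ j → j ∉ S → ρ j ≢ j

OntoOff : ∀ {m} → Subset m → (Fin m → Fin m) → Set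
OntoOff S ρ = ∀ i → i ∉ S → ∃[ j ] j ∉ S × ρ j ≡ i

module _ {m} {a : Fin m → Fin m → ℝ} (interior : ∀ i j → i ≢ j → 0# < a i j × a i j < 1#)
         {S : Subset m} {ρ : Fin m → Fin m} (noFix : NoFixedPointOff S ρ) where

  -- Off `S`, `ρ j ≢ j` puts `a (ρ j) j` strictly between 0 and 1, so the boundary coordinates are
  -- exactly those in `S`.
  point∈Box : ∀ c → Box a S ρ (point a S c ρ)
  point∈Box c = (λ j → cube j (j ∈? S)) , ((λ {j} → L⊆S j (j ∈? S)) , S⊆L) , off
    where
    cube : ∀ j (d : Dec (j ∈ S)) → 0# ≤ coordinate a S c ρ j d × coordinate a S c ρ j d ≤ 1#
    cube j (yes j∈S) = bit-inUnitInterval (finToFun c (position j∈S))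
    cube j (no  j∉S) = Product.map inj₁ inj₁ (interior (ρ j) j (noFix j j∉S))
    L⊆S : ∀ j (d : Dec (j ∈ S)) → coordinate a S c ρ j d ≈ 0# ⊎ coordinate a S c ρ j d ≈ 1# → j ∈ S
    L⊆S j (yes j∈S) _ = j∈S
    L⊆S j (no  j∉S) l = contradiction l
      (interior⇒∉L (proj₁ (interior (ρ j) j (noFix j j∉S))) (proj₂ (interior (ρ j) j (noFix j j∉S))))
    S⊆L : ∀ {j} → j ∈ S → L (point a S c ρ) j
    S⊆L {j} j∈S = subst (λ x → x ≈ 0# ⊎ x ≈ 1#) (≡.sym (point-∈ a S c ρ j∈S))
      (bit-boundary (finToFun c (position j∈S)))
    off : ∀ j → j ∉ S → point a S c ρ j ≈ a (ρ j) j
    off j j∉S = subst (_≈ a (ρ j) j) (≡.sym (point-∉ a S c ρ j∉S)) ≈-refl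

-- Only coordinates in `S` are compared, and there each is a bit; hence `ρ` and `σ` may differ.
point-injective : ∀ {m} {a : Fin m → Fin m → ℝ} {S c d ρ σ} →
                  (∀ j → point a S c ρ j ≈ point a S d σ j) → c ≡ d
point-injective {a = a} {S} {c} {d} {ρ} {σ} c≋d = finToFun-injective λ p →
  ≡.subst (λ q → finToFun c q ≡ finToFun d q) (position-elem S (elem∈ S p))
    (bit-injective (≡.subst₂ _≈_ (point-∈ a S c ρ (elem∈ S p)) (point-∈ a S d σ (elem∈ S p)) (c≋d (elem S p))))

point-surjective : ∀ {m} {a : Fin m → Fin m → ℝ} {S ρ γ} → Box a S ρ γ →
                   ∃[ c ] ∀ j → point a S c ρ j ≈ γ j
point-surjective {a = a} {S} {ρ} {γ} (_ , (_ , S⊆L) , off) = c , λ j → lemma j (j ∈? S)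
  where
  corner : ∀ p → ∃[ b ] bit b ≈ γ (elem S p)
  corner p = boundary⇒bit (S⊆L (elem∈ S p))
  c : Fin (2 ℕ.^ ∣ S ∣)
  c = funToFin (proj₁ ∘ corner)
  lemma : ∀ j d → coordinate a S c ρ j d ≈ γ j
  lemma j (yes j∈S) = ≡.subst₂ (λ b i → bit b ≈ γ i)
    (≡.sym (finToFun-funToFin (proj₁ ∘ corner) (position j∈S))) (elem-position j∈S)
    (proj₂ (corner (position j∈S)))
  lemma j (no j∉S) = ≈-sym (off j j∉S)

-- The subset is recovered as `L γ`. Off it, `ρ j` is recovered from `γ j`, because the admissible
-- entries `a i j` with fixed `j` are distinct. This gives both disjointness of the sets `EC a π`
-- and injectivity of the coding.
Box-unique : ∀ {m} {a : Fin m → Fin m → ℝ} →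
             (∀ i₁ i₂ j → i₁ ≢ i₂ → i₁ ≢ j → i₂ ≢ j → a i₁ j ≉ a i₂ j) →
             ∀ {S T ρ σ γ δ} → NoFixedPointOff S ρ → NoFixedPointOff T σ →
             (∀ j → γ j ≈ δ j) → Box a S ρ γ → Box a T σ δ →
             S ≡ T × (∀ j → j ∉ S → ρ j ≡ σ j)
Box-unique {a = a} distinct {S} {T} {ρ} {σ} noFixρ noFixσ γ≋δ
  (_ , (L⊆S , S⊆L) , offS) (_ , (L⊆T , T⊆L) , offT) =
  ⊆-antisym S⊆T T⊆S , agree
  where
  S⊆T : ∀ {j} → j ∈ S → j ∈ T
  S⊆T {j} j∈S = L⊆T (Sum.map (≈-trans (≈-sym (γ≋δ j))) (≈-trans (≈-sym (γ≋δ j))) (S⊆L j∈S))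
  T⊆S : ∀ {j} → j ∈ T → j ∈ S
  T⊆S {j} j∈T = L⊆S (Sum.map (≈-trans (γ≋δ j)) (≈-trans (γ≋δ j)) (T⊆L j∈T))
  agree : ∀ j → j ∉ S → ρ j ≡ σ j
  agree j j∉S = decidable-stable (ρ j ≟ σ j) λ ρj≢σj →
    distinct (ρ j) (σ j) j ρj≢σj (noFixρ j j∉S) (noFixσ j (j∉S ∘ T⊆S))
      (≈-trans (≈-sym (offS j j∉S)) (≈-trans (γ≋δ j) (offT j (j∉S ∘ T⊆S))))

-- Permutations and derangements of the non-fixed points

module _ {m} (π : Permutation′ m) where

  F⁺ : ∀ {j} → π ⟨$⟩ʳ j ≡ j → j ∈ F π
  F⁺ {j} fix = lookup⇒[]= j (F π) (≡.trans (lookup∘tabulate _ j) (dec-true (π ⟨$⟩ʳ j ≟ j) fix))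

  F⁻ : ∀ {j} → j ∈ F π → π ⟨$⟩ʳ j ≡ j
  F⁻ {j} j∈F with π ⟨$⟩ʳ j ≟ j
  ... | yes fix = fix
  ... | no  mov = contradiction
    (≡.trans (≡.sym (≡.trans (lookup∘tabulate _ j) (dec-false (π ⟨$⟩ʳ j ≟ j) mov))) ([]=⇒lookup j∈F)) λ ()

  F-noFixedPointOff : NoFixedPointOff (F π) (π ⟨$⟩ʳ_)
  F-noFixedPointOff j j∉F fix = j∉F (F⁺ fix)

  -- If `π` fixed the image of `j`, cancelling one application of `π` would make `j` fixed. Hence
  -- `π` restricts to its moved points.
  F-closedOff : ∀ {j} → j ∉ F π → π ⟨$⟩ʳ j ∉ F π
  F-closedOff {j} j∉F πj∈F = j∉F (F⁺ (begin
    π ⟨$⟩ʳ j                       ≡⟨ inverseˡ π ⟨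
    π ⟨$⟩ˡ (π ⟨$⟩ʳ (π ⟨$⟩ʳ j))     ≡⟨ cong (π ⟨$⟩ˡ_) (F⁻ πj∈F) ⟩
    π ⟨$⟩ˡ (π ⟨$⟩ʳ j)              ≡⟨ inverseˡ π ⟩
    j                              ∎))
    where open ≡-Reasoning

  F-ontoOff : OntoOff (F π) (π ⟨$⟩ʳ_)
  F-ontoOff i i∉F =
    π ⟨$⟩ˡ i , (λ j∈F → i∉F (subst (_∈ F π) (≡.trans (≡.sym (F⁻ j∈F)) (inverseʳ π)) j∈F)) , inverseʳ π

module _ {m} (S : Subset m) (d : Fin (! ∣ ∁ S ∣)) where

  private
    w : Vec (Fin ∣ ∁ S ∣) ∣ ∁ S ∣
    w = derangement d

  extendAt : ∀ j → Dec (j ∈ S) → Fin m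
  extendAt j (yes _)   = j
  extendAt j (no  j∉S) = elem (∁ S) (lookup w (position (x∉p⇒x∈∁p j∉S)))

  extend : Fin m → Fin m
  extend j = extendAt j (j ∈? S)

  extend-elem : ∀ q → extend (elem (∁ S) q) ≡ elem (∁ S) (lookup w q)
  extend-elem q = lemma (elem (∁ S) q ∈? S)
    where
    lemma : ∀ e → extendAt (elem (∁ S) q) e ≡ elem (∁ S) (lookup w q)
    lemma (yes j∈S) = contradiction j∈S (x∈∁p⇒x∉p (elem∈ (∁ S) q))
    lemma (no  j∉S) = cong (elem (∁ S) ∘ lookup w) (position-elem (∁ S) (x∉p⇒x∈∁p j∉S))

  -- In the coordinates given by `elem`, a fixed point off `S` is a fixed point of `w`.
  extend-noFixedPointOff : NoFixedPointOff S extend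
  extend-noFixedPointOff j j∉S fix = proj₂ (derangement-isDerangement d) q
    (elem-injective (∁ S) (begin
      elem (∁ S) (lookup w q)  ≡⟨ extend-elem q ⟨
      extend (elem (∁ S) q)    ≡⟨ cong extend (elem-position j∈∁S) ⟩
      extend j                 ≡⟨ fix ⟩
      j                        ≡⟨ elem-position j∈∁S ⟨
      elem (∁ S) q             ∎))
    where
    open ≡-Reasoning
    j∈∁S = x∉p⇒x∈∁p j∉S
    q = position j∈∁S

  extend-ontoOff : OntoOff S extend
  extend-ontoOff i i∉S =
    let i∈∁S = x∉p⇒x∈∁p i∉S
        (q , wq≡) = proj₂ (proj₁ (derangement-isDerangement d)) (position i∈∁S)
    in elem (∁ S) q , x∈∁p⇒x∉p (elem∈ (∁ S) q) ,
       ≡.trans (extend-elem q) (≡.trans (cong (elem (∁ S)) (wq≡ refl)) (elem-position i∈∁S))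

extend-injective : ∀ {m} (S : Subset m) {d e} → (∀ j → j ∉ S → extend S d j ≡ extend S e j) → d ≡ e
extend-injective S {d} {e} d≗e = derangement-injective (begin
  derangement d                     ≡⟨ tabulate∘lookup _ ⟨
  tabulate (lookup (derangement d)) ≡⟨ tabulate-cong (λ q → elem-injective (∁ S) (begin
      elem (∁ S) (lookup (derangement d) q) ≡⟨ extend-elem S d q ⟨
      extend S d (elem (∁ S) q)             ≡⟨ d≗e _ (x∈∁p⇒x∉p (elem∈ (∁ S) q)) ⟩
      extend S e (elem (∁ S) q)             ≡⟨ extend-elem S e q ⟩
      elem (∁ S) (lookup (derangement e) q) ∎)) ⟩
  tabulate (lookup (derangement e)) ≡⟨ tabulate∘lookup _ ⟩
  derangement e                     ∎)
  where open ≡-Reasoning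

-- The restriction of `π` to its moved points, written in the coordinates of `elem`, is a
-- derangement table `f` and therefore occurs in the list.
extend-surjective : ∀ {m} (π : Permutation′ m) → ∃[ d ] ∀ j → j ∉ F π → extend (F π) d j ≡ π ⟨$⟩ʳ j
extend-surjective {m} π = d , λ j j∉F → agree (x∉p⇒x∈∁p j∉F)
  where
  S = F π
  moved : ∀ q → π ⟨$⟩ʳ elem (∁ S) q ∈ ∁ S
  moved q = x∉p⇒x∈∁p (F-closedOff π (x∈∁p⇒x∉p (elem∈ (∁ S) q)))
  f : Fin ∣ ∁ S ∣ → Fin ∣ ∁ S ∣
  f q = position (moved q)
  elem-f : ∀ q → elem (∁ S) (f q) ≡ π ⟨$⟩ʳ elem (∁ S) q
  elem-f q = elem-position (moved q)
  f-injective : ∀ {p q} → f p ≡ f q → p ≡ q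
  f-injective {p} {q} eq = elem-injective (∁ S) (begin
    elem (∁ S) p                       ≡⟨ inverseˡ π ⟨
    π ⟨$⟩ˡ (π ⟨$⟩ʳ elem (∁ S) p)       ≡⟨ cong (π ⟨$⟩ˡ_) (≡.trans (≡.sym (elem-f p))
                                            (≡.trans (cong (elem (∁ S)) eq) (elem-f q))) ⟩
    π ⟨$⟩ˡ (π ⟨$⟩ʳ elem (∁ S) q)       ≡⟨ inverseˡ π ⟩
    elem (∁ S) q                       ∎)
    where open ≡-Reasoning
  w≗f : ∀ q → lookup (tabulate f) q ≡ f q
  w≗f = lookup∘tabulate f
  isDerangement : IsDerangement (tabulate f)
  isDerangement =
    ( (λ {p} {q} eq → f-injective (≡.trans (≡.sym (w≗f p)) (≡.trans eq (w≗f q))))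
    , (λ y → Product.map₂ (λ { {x} fx≡y refl → ≡.trans (w≗f x) fx≡y }) (injective⇒section f-injective y)) )
    , λ q eq → F-noFixedPointOff π _ (x∈∁p⇒x∉p (elem∈ (∁ S) q))
        (≡.trans (≡.sym (elem-f q)) (cong (elem (∁ S)) (≡.trans (≡.sym (w≗f q)) eq)))
  d : Fin (! ∣ ∁ S ∣)
  d = proj₁ (derangement-surjective (tabulate f) isDerangement)
  d≡ : derangement d ≡ tabulate f
  d≡ = proj₂ (derangement-surjective (tabulate f) isDerangement)
  agree : ∀ {j} → j ∈ ∁ S → extend S d j ≡ π ⟨$⟩ʳ j
  agree {j} j∈∁S = begin
    extend S d j                           ≡⟨ cong (extend S d) (elem-position j∈∁S) ⟨
    extend S d (elem (∁ S) q)              ≡⟨ extend-elem S d q ⟩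
    elem (∁ S) (lookup (derangement d) q)  ≡⟨ cong (λ w → elem (∁ S) (lookup w q)) d≡ ⟩
    elem (∁ S) (lookup (tabulate f) q)     ≡⟨ cong (elem (∁ S)) (w≗f q) ⟩
    elem (∁ S) (f q)                       ≡⟨ elem-f q ⟩
    π ⟨$⟩ʳ elem (∁ S) q                    ≡⟨ cong (π ⟨$⟩ʳ_) (elem-position j∈∁S) ⟩
    π ⟨$⟩ʳ j                               ∎
    where
    open ≡-Reasoning
    q = position j∈∁S

-- Equilibrium candidates of a product game

module ProductGame {m} (U : Game m) (v : Fin m → Fin 2) (a : Fin m → Fin m → ℝ)
                   (G : IsProductGame U v a) where

  private
    interior = proj₁ G
    distinct = proj₁ (proj₂ G)

  gain-zero⁺ : ∀ γ {i j} → j ≢ i → γ j ≈ a i j → gain U i γ ≈ 0#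
  gain-zero⁺ γ {i} = signedProduct-zero⁺ (a i) γ i {v i} (proj₂ (proj₂ G) i γ)

  -- Some factor of the product vanishes, and it is not the one at `i`, which is 1.
  gain-zero⁻ : ExcludedMiddle 0ℓ → ∀ γ {i} → gain U i γ ≈ 0# → ∃[ j ] j ≢ i × γ j ≈ a i j
  gain-zero⁻ em γ {i} = signedProduct-zero⁻ (a i) γ i em {v i} (proj₂ (proj₂ G) i γ)

  -- An interior `i` lies off `S`, so `i` is `ρ j` for some `j` off `S`, and the factor at `j` of
  -- the gain of `i` vanishes.
  Box⊆candidates : ∀ {S ρ γ} → NoFixedPointOff S ρ → OntoOff S ρ → Box a S ρ γ → EquilibriumCandidate U γ
  Box⊆candidates {S} {ρ} {γ} noFix onto (cube , (_ , S⊆L) , off) =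
    cube , λ i 0<γᵢ γᵢ<1 → indifferent i (onto i (interior⇒∉L 0<γᵢ γᵢ<1 ∘ S⊆L))
    where
    indifferent : ∀ i → ∃[ j ] j ∉ S × ρ j ≡ i → gain U i γ ≈ 0#
    indifferent i (j , j∉S , ρj≡i) =
      gain-zero⁺ γ (λ j≡i → noFix j j∉S (≡.trans ρj≡i (≡.sym j≡i)))
        (subst (λ k → γ j ≈ a k j) ρj≡i (off j j∉S))

  module _ (em : ExcludedMiddle 0ℓ) (γ : Vector ℝ m) (candidate : EquilibriumCandidate U γ) where

    -- Read as: `i` is to be the image of `j` under the permutation. The clause `¬ L γ j` keeps the
    -- two alternatives apart for a given `j`.
    Match : Fin m → Fin m → Set
    Match i j = (L γ i × j ≡ i) ⊎ (¬ L γ j × j ≢ i × γ j ≈ a i j)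

    match : ∀ i → ∃[ j ] Match i j
    match i = cases (proj₁ candidate i)
      where
      cases : 0# ≤ γ i × γ i ≤ 1# → ∃[ j ] Match i j
      cases (inj₂ 0≈γᵢ , _)         = i , inj₁ (inj₁ (≈-sym 0≈γᵢ) , refl)
      cases (inj₁ _ , inj₂ γᵢ≈1)    = i , inj₁ (inj₂ γᵢ≈1 , refl)
      cases (inj₁ 0<γᵢ , inj₁ γᵢ<1) =
        -- Being equal to `a i j`, the coordinate `γ j` is itself interior.
        Product.map₂ (λ {j} (j≢i , γⱼ≈aᵢⱼ) → inj₂ (interior⇒∉L
            (<-respʳ-≈ (≈-sym γⱼ≈aᵢⱼ) (proj₁ (interior i j (j≢i ∘ ≡.sym))))
            (<-respˡ-≈ (≈-sym γⱼ≈aᵢⱼ) (proj₂ (interior i j (j≢i ∘ ≡.sym)))) , j≢i , γⱼ≈aᵢⱼ))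
          (gain-zero⁻ em γ (proj₂ candidate i 0<γᵢ γᵢ<1))

    -- A boundary match and an interior match cannot share `j`; two interior ones with different `i`
    -- would equate distinct entries `a i j` and `a i′ j`.
    Match-injective : ∀ {i i′ j} → Match i j → Match i′ j → i ≡ i′
    Match-injective (inj₁ (_ , refl)) (inj₁ (_ , refl)) = refl
    Match-injective (inj₁ (l , refl)) (inj₂ (¬l , _))   = contradiction l ¬l
    Match-injective (inj₂ (¬l , _))   (inj₁ (l , refl)) = contradiction l ¬l
    Match-injective {i} {i′} {j} (inj₂ (_ , j≢i , γⱼ≈aᵢⱼ)) (inj₂ (_ , j≢i′ , γⱼ≈aᵢ′ⱼ)) =
      decidable-stable (i ≟ i′) λ i≢i′ → distinct i i′ j i≢i′ (j≢i ∘ ≡.sym) (j≢i′ ∘ ≡.sym)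
        (≈-trans (≈-sym γⱼ≈aᵢⱼ) γⱼ≈aᵢ′ⱼ)

    τ : Fin m → Fin m
    τ i = proj₁ (match i)

    τ-injective : ∀ {i i′} → τ i ≡ τ i′ → i ≡ i′
    τ-injective {i} {i′} eq = Match-injective (subst (Match i) eq (proj₂ (match i))) (proj₂ (match i′))

    τ⁻¹ : Fin m → Fin m
    τ⁻¹ j = proj₁ (injective⇒section τ-injective j)

    τ-τ⁻¹ : ∀ j → τ (τ⁻¹ j) ≡ j
    τ-τ⁻¹ j = proj₂ (injective⇒section τ-injective j)

    Match-τ⁻¹ : ∀ j → Match (τ⁻¹ j) j
    Match-τ⁻¹ j = subst (Match (τ⁻¹ j)) (τ-τ⁻¹ j) (proj₂ (match (τ⁻¹ j)))

    -- The forward map is `τ⁻¹`: matching sends `i` to `j`, whereas `EC` asks for `γ j ≈ a (π j) j`.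
    candidatePermutation : Permutation′ m
    candidatePermutation = permutation τ⁻¹ τ (λ i → τ-injective (τ-τ⁻¹ (τ i))) τ-τ⁻¹

    -- Everything is read off from the match of `j`: the first alternative makes `j` fixed and on
    -- the boundary, the second makes it moved and interior with the prescribed value.
    candidate∈EC : EC a candidatePermutation γ
    candidate∈EC = proj₁ candidate
                 , ((λ {j} → L⊆F j (Match-τ⁻¹ j)) , (λ {j} → F⊆L j (Match-τ⁻¹ j) ∘ F⁻ candidatePermutation))
                 , λ j j∉F → off j j∉F (Match-τ⁻¹ j)
      where
      L⊆F : ∀ j → Match (τ⁻¹ j) j → L γ j → j ∈ F candidatePermutation
      L⊆F j (inj₁ (_ , eq)) _ = F⁺ candidatePermutation (≡.sym eq)
      L⊆F j (inj₂ (¬l , _)) l = contradiction l ¬l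
      F⊆L : ∀ j → Match (τ⁻¹ j) j → τ⁻¹ j ≡ j → L γ j
      F⊆L j (inj₁ (l , eq))      _  = subst (L γ) (≡.sym eq) l
      F⊆L j (inj₂ (_ , neq , _)) eq = contradiction (≡.sym eq) neq
      off : ∀ j → j ∉ F candidatePermutation → Match (τ⁻¹ j) j → γ j ≈ a (τ⁻¹ j) j
      off j j∉F (inj₁ (_ , eq))    = contradiction (F⁺ candidatePermutation (≡.sym eq)) j∉F
      off j j∉F (inj₂ (_ , _ , h)) = h

  -- A common point forces equal fixed-point sets and agreement off them; on them both permutations
  -- are the identity.
  EC-disjoint : (π σ : Permutation′ m) → ¬ (π ≈ₚ σ) → EC a π ⊥ EC a σ
  EC-disjoint π σ π≉σ (γ∈ECπ , γ∈ECσ) = π≉σ λ j → agree j (j ∈? F π)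
    where
    unique = Box-unique distinct (F-noFixedPointOff π) (F-noFixedPointOff σ) (λ _ → ≈-refl) γ∈ECπ γ∈ECσ
    agree : ∀ j → Dec (j ∈ F π) → π ⟨$⟩ʳ j ≡ σ ⟨$⟩ʳ j
    agree j (yes j∈F) = ≡.trans (F⁻ π j∈F) (≡.sym (F⁻ σ (subst (j ∈_) (proj₁ unique) j∈F)))
    agree j (no  j∉F) = proj₂ unique j j∉F


  codePoint : Code m → Vector ℝ m
  codePoint (S , c , d) = point a S c (extend S d)

  codePoint∈Box : ∀ S c d → Box a S (extend S d) (codePoint (S , c , d))
  codePoint∈Box S c d = point∈Box interior (extend-noFixedPointOff S d) c

  codePoint-candidate : ∀ x → EquilibriumCandidate U (codePoint x)
  codePoint-candidate (S , c , d) =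
    Box⊆candidates {γ = codePoint (S , c , d)} (extend-noFixedPointOff S d) (extend-ontoOff S d)
      (codePoint∈Box S c d)

  codePoint-injective : ∀ x y → (∀ j → codePoint x j ≈ codePoint y j) → x ≡ y
  codePoint-injective (S , c , d) (T , c′ , d′) x≋y = code-≡ (proj₁ unique) (proj₂ unique) x≋y
    where
    unique : S ≡ T × (∀ j → j ∉ S → extend S d j ≡ extend T d′ j)
    unique = Box-unique distinct (extend-noFixedPointOff S d) (extend-noFixedPointOff T d′) x≋y
      (codePoint∈Box S c d) (codePoint∈Box T c′ d′)
    -- The types of `c′` and `d′` depend on `T`, so all three are generalised before `S ≡ T` is
    -- matched.
    code-≡ : ∀ {T c′ d′} → S ≡ T → (∀ j → j ∉ S → extend S d j ≡ extend T d′ j) →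
             (∀ j → codePoint (S , c , d) j ≈ codePoint (T , c′ , d′) j) → (S , c , d) ≡ (T , c′ , d′)
    code-≡ refl agree x≋y = cong (S ,_) (cong₂ _,_
      (point-injective {a = a} {ρ = extend S d} x≋y) (extend-injective S agree))

  -- The code consists of the fixed points of the permutation found, the bits of `γ` there, and the
  -- derangement index of its restriction. Agreement off `F π` turns the box of `π` into that of
  -- `extend`.
  codePoint-surjective : ExcludedMiddle 0ℓ → ∀ γ → EquilibriumCandidate U γ →
                         ∃[ x ] ∀ j → codePoint x j ≈ γ j
  codePoint-surjective em γ candidate = (F π , proj₁ corner , d) , proj₂ corner
    where
    π = candidatePermutation em γ candidate
    γ∈EC = candidate∈EC em γ candidate
    d = proj₁ (extend-surjective π)
    corner : ∃[ c ] ∀ j → point a (F π) c (extend (F π) d) j ≈ γ j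
    corner = point-surjective {γ = γ} (proj₁ γ∈EC , proj₁ (proj₂ γ∈EC) , λ j j∉F →
      subst (λ i → γ j ≈ a i j) (≡.sym (proj₂ (extend-surjective π) j j∉F)) (proj₂ (proj₂ γ∈EC) j j∉F))

  candidates-cardinality : ExcludedMiddle 0ℓ → HasCardinality (EquilibriumCandidate U) (V m)
  candidates-cardinality em = record
    { to        = λ k → codePoint (decode k) , codePoint-candidate (decode k)
    ; cong      = λ { refl j → ≈-refl }
    ; bijective =
        (λ {k} {l} eq → ≡.trans (≡.sym (encode-decode k))
          (≡.trans (cong encode (codePoint-injective (decode k) (decode l) eq)) (encode-decode l)))
      , λ (γ , candidate) →
          let (x , x≋γ) = codePoint-surjective em γ candidate
          in encode x , λ { refl j → subst (λ y → codePoint y j ≈ γ j) (≡.sym (decode-encode x)) (x≋γ j) }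
    }
    where
    open Inverse (V↔Code m) using () renaming
      ( to to decode; from to encode
      ; strictlyInverseˡ to decode-encode; strictlyInverseʳ to encode-decode )

  candidates⊆⋃EC : ExcludedMiddle 0ℓ → EquilibriumCandidate U ⊆ ⋃ (Permutation′ m) (EC a)
  candidates⊆⋃EC em {γ} candidate = candidatePermutation em γ candidate , candidate∈EC em γ candidate

  EC⊆candidates : ∀ π {γ} → EC a π γ → EquilibriumCandidate U γ
  EC⊆candidates π {γ} γ∈EC =
    Box⊆candidates {F π} {π ⟨$⟩ʳ_} {γ} (F-noFixedPointOff π) (F-ontoOff π) γ∈EC

  candidates≐⋃EC : ExcludedMiddle 0ℓ → EquilibriumCandidate U ≐ ⋃ (Permutation′ m) (EC a)
  candidates≐⋃EC em = (λ {γ} → candidates⊆⋃EC em {γ}) , (λ {γ} (π , γ∈EC) → EC⊆candidates π {γ} γ∈EC)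

  -- With `π` given, the only freedom left is the word of bits on `F π`.
  EC-cardinality : (π : Permutation′ m) → HasCardinality (EC a π) (2 ℕ.^ ∣ F π ∣)
  EC-cardinality π = record
    { to        = λ c → point a (F π) c (π ⟨$⟩ʳ_) , point∈Box interior (F-noFixedPointOff π) c
    ; cong      = λ { refl j → ≈-refl }
    ; bijective = point-injective {a = a} {S = F π}
                , λ (γ , γ∈EC) → Product.map₂ (λ { c≋γ refl → c≋γ }) (point-surjective {a = a} {γ = γ} γ∈EC)
    }

theorem3p7 : ExcludedMiddle 0ℓ →
    (m : ℕ) → 1 ℕ.≤ m →
    (U : Game m) (v : Fin m → Fin 2) (a : Fin m → Fin m → ℝ) →
    IsProductGame U v a →
    (EquilibriumCandidate U ≐ ⋃ (Permutation′ m) (EC a))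
    × (∀ (π σ : Permutation′ m) → ¬ (π ≈ₚ σ) → EC a π ⊥ EC a σ)
    × (∀ (π : Permutation′ m) → HasCardinality (EC a π) (2 ℕ.^ ∣ F π ∣))
    × HasCardinality (EquilibriumCandidate U) (V m)
theorem3p7 em m _ U v a G =
  candidates≐⋃EC em , EC-disjoint , EC-cardinality , candidates-cardinality em
  where open ProductGame U v a G
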